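{- The inequality of the values of $\sigma(x)/x$ for any pair of different coprime natural numbers is a necessary condition for the non-existence of an odd multiply perfect number. That is: if there is no odd multiply perfect number, then $\dfrac{\sigma(x)}{x}\ne\dfrac{\sigma(y)}{y}$ for all coprime $x,y\in\mathbb{N}$ with $x\ne y$.
   Context: $\mathbb{N}$ is the set of positive integers and $\sigma(x)=\sum_{d\mid x}d$ is the sum of the positive divisors of $x$. A number $m\in\mathbb{N}$ is multiply perfect if $\sigma(m)=k\cdot m$ for some integer $k\ge2$. -}

module Defs where

open import Data.List.Base using (List; applyUpTo; filter)
open import Data.Nat.Base using (ℕ; suc; NonZero; _≤_; _*_)
open import Data.Nat.Divisibility using (_∣_; _∣?_)
open import Data.Nat.ListAction using (sum)
open import Data.Product.Base using (∃-syntax; _×_)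
open import Relation.Binary.PropositionalEquality.Core using (_≡_)
open import Relation.Nullary.Negation.Core using (¬_)

-- The candidates are 1, …, n.  For n = 0 this is the empty list, so only the
-- values at positive n are meaningful.
divisors : ℕ → List ℕ
divisors n = filter (_∣? n) (applyUpTo suc n)

σ : ℕ → ℕ
σ n = sum (divisors n)

-- Positivity is required explicitly: σ 0 ≡ 2 * 0 would otherwise admit 0.
MultiplyPerfect : ℕ → Set
MultiplyPerfect m = NonZero m × (∃[ k ] (2 ≤ k × σ m ≡ k * m))

Odd : ℕ → Set
Odd m = ¬ (2 ∣ m)

{-# OPTIONS --safe #-}
-- Write σ(x)/x = σ(y)/y as σ(x) y = σ(y) x.  Coprimality gives x ∣ σ(x) and
-- y ∣ σ(y), and one of x, y is odd, say x.  Since σ(n) > n for n > 1, either x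
-- is an odd multiply perfect number, or x = 1; in the latter case σ(y) = y, so
-- y = 1 = x.
module Submission where

open import Defs
open import Data.Integer.Base using (+_)
open import Data.List.Base using (List; _∷_; applyUpTo; filter)
open import Data.List.Membership.Propositional using (_∈_)
open import Data.List.Membership.Propositional.Properties using (∈-applyUpTo⁺; ∈-filter⁺)
open import Data.List.Properties using (filter-accept)
open import Data.List.Relation.Unary.Any using (here; there)
open import Data.Nat.Base using (ℕ; suc; 2+; NonZero; NonTrivial; _*_; _≤_; _<_; s≤s)
open import Data.Nat.Coprimality as Coprimality using (Coprime; coprime-divisor)
open import Data.Nat.Divisibility using (_∣_; _∣?_; divides; 1∣_; ∣-refl)
open import Data.Nat.ListAction using (sum)
open import Data.Nat.Properties
  using (≤-refl; ≤-trans; m≤m+n; m≤n+m; <-irrefl; *-comm; *-identityˡ; *-identityʳ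
        ; *-cancelʳ-<; module ≤-Reasoning)
open import Data.Product.Base using (∃-syntax; _×_; _,_)
open import Data.Rational.Base using (_/_)
open import Data.Rational.Properties using (normalize-injective-≃)
open import Relation.Binary.PropositionalEquality.Core using (_≡_; _≢_; refl; sym; trans; cong; ≢-sym)
open import Relation.Nullary.Decidable.Core using (yes; no)
open import Relation.Nullary.Negation.Core using (¬_; contradiction)

∈⇒≤sum : ∀ {n} {ns : List ℕ} → n ∈ ns → n ≤ sum ns
∈⇒≤sum {n} {_ ∷ ns} (here refl)  = m≤m+n n (sum ns)
∈⇒≤sum {n} {m ∷ ns} (there n∈ns) = ≤-trans (∈⇒≤sum n∈ns) (m≤n+m (sum ns) m)

-- The divisors `1` and `n` are distinct once `n` is at least 2, so together they already contribute
-- `1 + n` to the sum.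
n<σ[n] : ∀ n → .{{NonTrivial n}} → n < σ n
n<σ[n] n@(2+ k) = begin
  suc n                           ≤⟨ s≤s (∈⇒≤sum n∈rest) ⟩
  suc (sum (filter (_∣? n) rest)) ≡⟨ cong sum (filter-accept (_∣? n) {xs = rest} (1∣ n)) ⟨
  σ n                             ∎
  where
  open ≤-Reasoning
  -- The candidates from 2 to `n`, left over once the head 1 has been accepted as a divisor; `n` is
  -- the entry at index `k`.
  rest : List ℕ
  rest = applyUpTo 2+ (suc k)
  n∈rest : n ∈ filter (_∣? n) rest
  n∈rest = ∈-filter⁺ (_∣? n) (∈-applyUpTo⁺ 2+ ≤-refl) ∣-refl

-- The quotient exceeds 1 because `σ n` exceeds `n`.
n∣σ[n]⇒multiplyPerfect : ∀ n → .{{NonTrivial n}} → n ∣ σ n → MultiplyPerfect n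
n∣σ[n]⇒multiplyPerfect n@(2+ _) (divides k σn≡k*n) = _ , k , 1<k , σn≡k*n
  where
  open ≤-Reasoning
  1<k : 1 < k
  1<k = *-cancelʳ-< n 1 k (begin-strict
    1 * n  ≡⟨ *-identityˡ n ⟩
    n      <⟨ n<σ[n] n ⟩
    σ n    ≡⟨ σn≡k*n ⟩
    k * n  ∎)

σ[n]≡n⇒n≡1 : ∀ n → .{{NonZero n}} → σ n ≡ n → n ≡ 1
σ[n]≡n⇒n≡1 1        _    = refl
σ[n]≡n⇒n≡1 n@(2+ _) σn≡n = contradiction (n<σ[n] n) (<-irrefl (sym σn≡n))

-- The right side of the equation is a multiple of `x`, hence so is the left; as `x` is coprime to
-- the factor `y`, Euclid's lemma applies to the other factor.
coprime⇒∣σ : ∀ {x y} → Coprime x y → σ x * y ≡ σ y * x → x ∣ σ x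
coprime⇒∣σ {x} {y} c eq = coprime-divisor c (divides (σ y) (trans (*-comm y (σ x)) eq))

σ-ratio-odd : ¬ (∃[ m ] (Odd m × MultiplyPerfect m)) →
  ∀ x y → .{{NonZero x}} → .{{NonZero y}} →
  Odd x → Coprime x y → x ≢ y → σ x * y ≢ σ y * x
-- The number 1 is not multiply perfect, its quotient being 1. Since `σ 1` evaluates to 1, `eq`
-- amounts to `σ y ≡ y`.
σ-ratio-odd _ 1 y _ _ 1≢y eq =
  1≢y (sym (σ[n]≡n⇒n≡1 y (trans (sym (*-identityʳ (σ y))) (trans (sym eq) (*-identityˡ y)))))
σ-ratio-odd none x@(2+ _) y odd c _ eq =
  none (x , odd , n∣σ[n]⇒multiplyPerfect x (coprime⇒∣σ c eq))

corollary6p4 : ¬ (∃[ m ] (Odd m × MultiplyPerfect m)) →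
    ∀ (x y : ℕ) .{{_ : NonZero x}} .{{_ : NonZero y}} →
    Coprime x y → x ≢ y → (+ σ x) / x ≢ (+ σ y) / y
corollary6p4 none x@(suc _) y@(suc _) c x≢y eq with 2 ∣? x
-- Equality of the normalised fractions yields equality of the cross products.
... | no  2∤x = σ-ratio-odd none x y 2∤x c x≢y (normalize-injective-≃ (σ x) (σ y) x y eq)
-- Now 2 cannot divide `y` as well, and the cross-multiplied equation is symmetric, so `x` and `y`
-- exchange roles.
... | yes 2∣x = σ-ratio-odd none y x 2∤y (Coprimality.sym c) (≢-sym x≢y)
                  (sym (normalize-injective-≃ (σ x) (σ y) x y eq))
  where
  2∤y : Odd y
  2∤y 2∣y = contradiction (c (2∣x , 2∣y)) λ ()
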